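{- For all graphs $G$ and $H$, \[\chi_q(G \,\square\, H) = \max\{\chi_q(G), \chi_q(H)\}.\]
   Context: Graphs are finite, simple and undirected; no vertex is adjacent to itself. The Cartesian product $G \,\square\, H$ has vertex set $V(G)\times V(H)$, with $(u_1,v_1)\sim(u_2,v_2)$ iff ($u_1\sim u_2$ and $v_1=v_2$) or ($u_1=u_2$ and $v_1\sim v_2$). For a graph $H$ and integer $d\ge1$, the measurement graph $M(H,d)$ has as vertices all tuples $\mathbf{E}=(E_v)_{v\in V(H)}$ of orthogonal projectors $E_v\in\mathbb{C}^{d\times d}$ with $\sum_{v\in V(H)}E_v=I$; two vertices $\mathbf{E},\mathbf{E}'$ are adjacent iff $E_vE'_{v'}=0$ for all $v,v'\in V(H)$ with $v\not\sim v'$ (in particular for $v=v'$). A quantum homomorphism from $G$ to $H$ is a graph homomorphism from $G$ to $M(H,d)$ for some $d$. The quantum chromatic number $\chi_q(G)$ is the least $n$ such that there is a quantum homomorphism from $G$ to the complete graph $K_n$. -}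

module Defs where

open import Algebra.Bundles using (CommutativeRing; RawRing)
import Algebra.Definitions.RawMonoid as RawMonoidDefinitions
import Algebra.Properties.AbelianGroup as AbelianGroupProperties
import Algebra.Properties.CommutativeSemigroup as CommutativeSemigroupProperties
import Algebra.Properties.Ring as RingProperties
open import Data.Bool.Base using (if_then_else_)
open import Data.Fin.Base using (Fin)
import Data.Fin.Properties as Fin
open import Data.Nat.Base as ℕ using (ℕ)
import Data.Nat.Properties as ℕ
open import Data.Product.Base using (_×_; _,_; ∃-syntax)
open import Data.Product.Function.NonDependent.Propositional using (_×-↔_)
open import Data.Rational.Base as ℚ using (ℚ; 0ℚ; 1ℚ; ½; ∣_∣)
import Data.Rational.Properties as ℚ
open import Data.Sum.Base as Sum using (_⊎_; inj₁; inj₂)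
open import Data.Vec.Functional using (Vector)
open import Function.Bundles using (_↔_; Inverse)
open import Function.Construct.Composition using (_↔-∘_)
open import Function.Construct.Identity using (↔-id)
open import Level using (0ℓ)
open import Relation.Binary.Core using (Rel)
open import Relation.Binary.Definitions using (Symmetric; Irreflexive)
open import Relation.Binary.Morphism.Structures using (IsRelHomomorphism)
open import Relation.Binary.PropositionalEquality
  using (_≡_; _≢_; refl; sym; trans; cong; subst; module ≡-Reasoning)
open import Relation.Nullary using (¬_)
open import Relation.Nullary.Decidable using (⌊_⌋)

-- Proved over an arbitrary commutative ring because normalising concrete
-- rational arithmetic during type checking is very slow.
module DifferenceIdentities {c ℓ} (R : CommutativeRing c ℓ) where
  open CommutativeRing R hiding (refl; sym; trans)
  open RingProperties ring using (x[y-z]≈xy-xz; [y-z]x≈yx-zx)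
  open AbelianGroupProperties +-abelianGroup using (⁻¹-∙-comm; //-rightDividesˡ)
  open CommutativeSemigroupProperties +-commutativeSemigroup using (interchange)
  open import Relation.Binary.Reasoning.Setoid setoid

  y+[x-y]≈x : ∀ x y → y + (x - y) ≈ x
  y+[x-y]≈x x y = begin
    y + (x - y)  ≈⟨ +-comm y (x - y) ⟩
    (x - y) + y  ≈⟨ //-rightDividesˡ y x ⟩
    x            ∎

  [a-c]+[b-d]≈[a+b]-[c+d] : ∀ a b c d → (a - c) + (b - d) ≈ (a + b) - (c + d)
  [a-c]+[b-d]≈[a+b]-[c+d] a b c d = begin
    (a - c) + (b - d)        ≈⟨ interchange a (- c) b (- d) ⟩
    (a + b) + (- c + (- d))  ≈⟨ +-congˡ (⁻¹-∙-comm c d) ⟩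
    (a + b) - (c + d)        ∎

  -a--c≈-[a-c] : ∀ a c → - a - (- c) ≈ - (a - c)
  -a--c≈-[a-c] a c = ⁻¹-∙-comm a (- c)

  [a-b]+[b-c]≈a-c : ∀ a b c → (a - b) + (b - c) ≈ a - c
  [a-b]+[b-c]≈a-c a b c = begin
    (a - b) + (b - c)    ≈⟨ +-assoc (a - b) b (- c) ⟨
    ((a - b) + b) - c    ≈⟨ +-congʳ (//-rightDividesˡ b a) ⟩
    a - c                ∎

  a[b-d]+[a-c]d≈ab-cd : ∀ a b c d → a * (b - d) + (a - c) * d ≈ a * b - c * d
  a[b-d]+[a-c]d≈ab-cd a b c d = begin
    a * (b - d) + (a - c) * d          ≈⟨ +-cong (x[y-z]≈xy-xz a b d) ([y-z]x≈yx-zx d a c) ⟩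
    (a * b - a * d) + (a * d - c * d)  ≈⟨ [a-b]+[b-c]≈a-c (a * b) (a * d) (c * d) ⟩
    a * b - c * d                      ∎

open DifferenceIdentities ℚ.+-*-commutativeRing

-- The real numbers are Cauchy sequences of rationals; _≈ℝ_, that the
-- difference tends to 0, is their equality.
IsCauchy : (ℕ → ℚ) → Set
IsCauchy x = ∀ ε → 0ℚ ℚ.< ε →
  ∃[ N ] (∀ m n → N ℕ.≤ m → N ℕ.≤ n → ∣ x m ℚ.- x n ∣ ℚ.< ε)

record ℝ : Set where
  constructor mkℝ
  field
    seq      : ℕ → ℚ
    isCauchy : IsCauchy seq

open ℝ public

infix 4 _≈ℝ_

_≈ℝ_ : Rel ℝ 0ℓ
x ≈ℝ y = ∀ ε → 0ℚ ℚ.< ε →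
  ∃[ N ] (∀ n → N ℕ.≤ n → ∣ seq x n ℚ.- seq y n ∣ ℚ.< ε)

0<p*q : ∀ {p q} → 0ℚ ℚ.< p → 0ℚ ℚ.< q → 0ℚ ℚ.< p ℚ.* q
0<p*q {p} {q} 0<p 0<q =
  ℚ.positive⁻¹ _ {{ℚ.pos*pos⇒pos p {{ℚ.positive 0<p}} q {{ℚ.positive 0<q}}}}

ε*½+ε*½≡ε : ∀ ε → ε ℚ.* ½ ℚ.+ ε ℚ.* ½ ≡ ε
ε*½+ε*½≡ε ε = begin
  ε ℚ.* ½ ℚ.+ ε ℚ.* ½  ≡⟨ ℚ.*-distribˡ-+ ε ½ ½ ⟨
  ε ℚ.* 1ℚ             ≡⟨ ℚ.*-identityʳ ε ⟩
  ε                    ∎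
  where open ≡-Reasoning

0<ε*½ : ∀ {ε} → 0ℚ ℚ.< ε → 0ℚ ℚ.< ε ℚ.* ½
0<ε*½ 0<ε = 0<p*q 0<ε (ℚ.positive⁻¹ ½)

∣p+q∣<ε : ∀ p q ε → ∣ p ∣ ℚ.< ε ℚ.* ½ → ∣ q ∣ ℚ.< ε ℚ.* ½ → ∣ p ℚ.+ q ∣ ℚ.< ε
∣p+q∣<ε p q ε p<ε/2 q<ε/2 = begin-strict
  ∣ p ℚ.+ q ∣          ≤⟨ ℚ.∣p+q∣≤∣p∣+∣q∣ p q ⟩
  ∣ p ∣ ℚ.+ ∣ q ∣      <⟨ ℚ.+-mono-< p<ε/2 q<ε/2 ⟩
  ε ℚ.* ½ ℚ.+ ε ℚ.* ½  ≡⟨ ε*½+ε*½≡ε ε ⟩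
  ε                    ∎
  where open ℚ.≤-Reasoning

EventuallyBounded : (ℕ → ℚ) → ℚ → Set
EventuallyBounded x B = ∃[ N ] (∀ n → N ℕ.≤ n → ∣ x n ∣ ℚ.≤ B)

cauchy⇒bounded : ∀ x → IsCauchy x → ∃[ B ] 0ℚ ℚ.< B × EventuallyBounded x B
cauchy⇒bounded x cx with cx 1ℚ (ℚ.positive⁻¹ 1ℚ)
... | N , close = ∣ x N ∣ ℚ.+ 1ℚ , 0<B , N , bound
  where
  0<B : 0ℚ ℚ.< ∣ x N ∣ ℚ.+ 1ℚ
  0<B = ℚ.+-mono-≤-< (ℚ.0≤∣p∣ (x N)) (ℚ.positive⁻¹ 1ℚ)

  open ℚ.≤-Reasoning
  bound : ∀ n → N ℕ.≤ n → ∣ x n ∣ ℚ.≤ ∣ x N ∣ ℚ.+ 1ℚ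
  bound n N≤n = begin
    ∣ x n ∣                        ≡⟨ cong ∣_∣ (y+[x-y]≈x (x n) (x N)) ⟨
    ∣ x N ℚ.+ (x n ℚ.- x N) ∣      ≤⟨ ℚ.∣p+q∣≤∣p∣+∣q∣ (x N) (x n ℚ.- x N) ⟩
    ∣ x N ∣ ℚ.+ ∣ x n ℚ.- x N ∣    ≤⟨ ℚ.+-monoʳ-≤ ∣ x N ∣ (ℚ.<⇒≤ (close n N N≤n ℕ.≤-refl)) ⟩
    ∣ x N ∣ ℚ.+ 1ℚ                 ∎

∣p*q∣<ε : ∀ {B} p q ε (0<B : 0ℚ ℚ.< B) → ∣ p ∣ ℚ.≤ B →
          ∣ q ∣ ℚ.< (ε ℚ.÷ B) {{ℚ.>-nonZero 0<B}} → ∣ p ℚ.* q ∣ ℚ.< ε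
∣p*q∣<ε {B} p q ε 0<B p≤B q<ε/B = begin-strict
  ∣ p ℚ.* q ∣                ≡⟨ ℚ.∣p*q∣≡∣p∣*∣q∣ p q ⟩
  ∣ p ∣ ℚ.* ∣ q ∣            ≤⟨ ℚ.*-monoʳ-≤-nonNeg ∣ q ∣ {{ℚ.∣-∣-nonNeg q}} p≤B ⟩
  B ℚ.* ∣ q ∣                <⟨ ℚ.*-monoʳ-<-pos B q<ε/B ⟩
  B ℚ.* (ε ℚ.* ℚ.1/ B)       ≡⟨ ℚ.*-comm B (ε ℚ.* ℚ.1/ B) ⟩
  ε ℚ.* ℚ.1/ B ℚ.* B         ≡⟨ ℚ.*-assoc ε (ℚ.1/ B) B ⟩
  ε ℚ.* (ℚ.1/ B ℚ.* B)       ≡⟨ cong (ε ℚ.*_) (ℚ.*-inverseˡ B) ⟩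
  ε ℚ.* 1ℚ                   ≡⟨ ℚ.*-identityʳ ε ⟩
  ε                          ∎
  where
  open ℚ.≤-Reasoning
  instance
    B≢0 = ℚ.>-nonZero 0<B
    B>0 = ℚ.positive 0<B

0<ε÷B : ∀ {B ε} (0<B : 0ℚ ℚ.< B) → 0ℚ ℚ.< ε → 0ℚ ℚ.< (ε ℚ.÷ B) {{ℚ.>-nonZero 0<B}}
0<ε÷B {B} 0<B 0<ε = 0<p*q 0<ε (ℚ.positive⁻¹ _ {{ℚ.1/pos⇒pos B {{ℚ.positive 0<B}}}})

-- Abstract, so that comparing real numbers never unfolds these moduli.
abstract
  const-isCauchy : ∀ q → IsCauchy (λ _ → q)
  const-isCauchy q ε 0<ε =
    0 , λ _ _ _ _ → subst (ℚ._< ε) (sym (cong ∣_∣ (ℚ.+-inverseʳ q))) 0<ε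

  +-isCauchy : ∀ x y → IsCauchy x → IsCauchy y → IsCauchy (λ n → x n ℚ.+ y n)
  +-isCauchy x y cx cy ε 0<ε
    with cx (ε ℚ.* ½) (0<ε*½ 0<ε) | cy (ε ℚ.* ½) (0<ε*½ 0<ε)
  ... | M , closeˣ | N , closeʸ = M ℕ.⊔ N , λ m n ≤m ≤n →
    subst (λ z → ∣ z ∣ ℚ.< ε)
      ([a-c]+[b-d]≈[a+b]-[c+d] (x m) (y m) (x n) (y n))
      (∣p+q∣<ε (x m ℚ.- x n) (y m ℚ.- y n) ε
        (closeˣ m n (ℕ.m⊔n≤o⇒m≤o M N ≤m) (ℕ.m⊔n≤o⇒m≤o M N ≤n))
        (closeʸ m n (ℕ.m⊔n≤o⇒n≤o M N ≤m) (ℕ.m⊔n≤o⇒n≤o M N ≤n)))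

  neg-isCauchy : ∀ x → IsCauchy x → IsCauchy (λ n → ℚ.- x n)
  neg-isCauchy x cx ε 0<ε with cx ε 0<ε
  ... | N , close = N , λ m n N≤m N≤n →
    subst (ℚ._< ε)
      (sym (trans (cong ∣_∣ (-a--c≈-[a-c] (x m) (x n)))
                  (ℚ.∣-p∣≡∣p∣ (x m ℚ.- x n))))
      (close m n N≤m N≤n)

  *-isCauchy : ∀ x y → IsCauchy x → IsCauchy y → IsCauchy (λ n → x n ℚ.* y n)
  *-isCauchy x y cx cy ε 0<ε =
    let B , 0<B , K , boundˣ = cauchy⇒bounded x cx
        C , 0<C , L , boundʸ = cauchy⇒bounded y cy
        M , closeˣ = cx _ (0<ε÷B 0<C (0<ε*½ 0<ε))
        N , closeʸ = cy _ (0<ε÷B 0<B (0<ε*½ 0<ε))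
        ≤KL : ∀ {i} → (K ℕ.⊔ L) ℕ.⊔ (M ℕ.⊔ N) ℕ.≤ i → K ℕ.⊔ L ℕ.≤ i
        ≤KL = ℕ.m⊔n≤o⇒m≤o (K ℕ.⊔ L) (M ℕ.⊔ N)
        ≤MN : ∀ {i} → (K ℕ.⊔ L) ℕ.⊔ (M ℕ.⊔ N) ℕ.≤ i → M ℕ.⊔ N ℕ.≤ i
        ≤MN = ℕ.m⊔n≤o⇒n≤o (K ℕ.⊔ L) (M ℕ.⊔ N)
    in (K ℕ.⊔ L) ℕ.⊔ (M ℕ.⊔ N) , λ m n ≤m ≤n →
    subst (λ z → ∣ z ∣ ℚ.< ε)
      (a[b-d]+[a-c]d≈ab-cd (x m) (y m) (x n) (y n))
      (∣p+q∣<ε (x m ℚ.* (y m ℚ.- y n)) ((x m ℚ.- x n) ℚ.* y n) ε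
        (∣p*q∣<ε (x m) (y m ℚ.- y n) (ε ℚ.* ½) 0<B
          (boundˣ m (ℕ.m⊔n≤o⇒m≤o K L (≤KL ≤m)))
          (closeʸ m n (ℕ.m⊔n≤o⇒n≤o M N (≤MN ≤m)) (ℕ.m⊔n≤o⇒n≤o M N (≤MN ≤n))))
        (subst (λ z → ∣ z ∣ ℚ.< ε ℚ.* ½) (ℚ.*-comm (y n) (x m ℚ.- x n))
          (∣p*q∣<ε (y n) (x m ℚ.- x n) (ε ℚ.* ½) 0<C
            (boundʸ n (ℕ.m⊔n≤o⇒n≤o K L (≤KL ≤n)))
            (closeˣ m n (ℕ.m⊔n≤o⇒m≤o M N (≤MN ≤m)) (ℕ.m⊔n≤o⇒m≤o M N (≤MN ≤n))))))

infix  8 -ℝ_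
infixl 7 _*ℝ_
infixl 6 _+ℝ_

fromℚ : ℚ → ℝ
fromℚ q = mkℝ (λ _ → q) (const-isCauchy q)

_+ℝ_ : ℝ → ℝ → ℝ
x +ℝ y = mkℝ (λ n → seq x n ℚ.+ seq y n)
             (+-isCauchy (seq x) (seq y) (isCauchy x) (isCauchy y))

-ℝ_ : ℝ → ℝ
-ℝ x = mkℝ (λ n → ℚ.- seq x n) (neg-isCauchy (seq x) (isCauchy x))

_*ℝ_ : ℝ → ℝ → ℝ
x *ℝ y = mkℝ (λ n → seq x n ℚ.* seq y n)
             (*-isCauchy (seq x) (seq y) (isCauchy x) (isCauchy y))

infix 6 _+i_

record ℂ : Set where
  constructor _+i_
  field
    re im : ℝ

open ℂ public

ℂ-rawRing : RawRing 0ℓ 0ℓ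
ℂ-rawRing = record
  { Carrier = ℂ
  ; _≈_     = λ z w → re z ≈ℝ re w × im z ≈ℝ im w
  ; _+_     = λ z w → (re z +ℝ re w) +i (im z +ℝ im w)
  ; _*_     = λ z w → (re z *ℝ re w +ℝ -ℝ (im z *ℝ im w))
                   +i (re z *ℝ im w +ℝ im z *ℝ re w)
  ; -_      = λ z → (-ℝ re z) +i (-ℝ im z)
  ; 0#      = fromℚ 0ℚ +i fromℚ 0ℚ
  ; 1#      = fromℚ 1ℚ +i fromℚ 0ℚ
  }

open RawRing ℂ-rawRing public
  using ()
  renaming ( _≈_ to _≈ℂ_; _+_ to _+ℂ_; _*_ to _*ℂ_; -_ to -ℂ_
           ; 0# to 0ℂ; 1# to 1ℂ; +-rawMonoid to ℂ-+-rawMonoid )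

open RawMonoidDefinitions ℂ-+-rawMonoid public
  using () renaming (sum to sumℂ)

conj : ℂ → ℂ
conj z = re z +i (-ℝ im z)

Matrix : ℕ → Set
Matrix d = Fin d → Fin d → ℂ

infix  4 _≈ᴹ_
infixl 7 _*ᴹ_
infix  8 _†

_≈ᴹ_ : ∀ {d} → Rel (Matrix d) 0ℓ
A ≈ᴹ B = ∀ i j → A i j ≈ℂ B i j

0ᴹ : ∀ {d} → Matrix d
0ᴹ _ _ = 0ℂ

1ᴹ : ∀ {d} → Matrix d
1ᴹ i j = if ⌊ i Fin.≟ j ⌋ then 1ℂ else 0ℂ

_*ᴹ_ : ∀ {d} → Matrix d → Matrix d → Matrix d
(A *ᴹ B) i j = sumℂ (λ k → A i k *ℂ B k j)

_† : ∀ {d} → Matrix d → Matrix d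
(A †) i j = conj (A j i)

sumᴹ : ∀ {n d} → Vector (Matrix d) n → Matrix d
sumᴹ As i j = sumℂ (λ k → As k i j)

record IsOrthogonalProjector {d} (E : Matrix d) : Set where
  field
    selfAdjoint : E † ≈ᴹ E
    idempotent  : E *ᴹ E ≈ᴹ E

-- The bare data (vertices, adjacency) that homomorphisms refer to.
-- Vertex sets may be infinite: measurement graphs are of this kind.
record Graph : Set₁ where
  infix 4 _∼_
  field
    V   : Set
    _∼_ : Rel V 0ℓ

record FiniteGraph : Set₁ where
  field
    graph : Graph
  open Graph graph public
  field
    ∼-sym    : Symmetric _∼_
    ∼-irrefl : Irreflexive _≡_ _∼_
    order    : ℕ
    enum     : Fin order ↔ V

  vertex : Fin order → V
  vertex = Inverse.to enum

open FiniteGraph public using (graph)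

Vertex : FiniteGraph → Set
Vertex = FiniteGraph.V

record Hom (G H : Graph) : Set where
  private
    module G = Graph G
    module H = Graph H
  field
    map   : G.V → H.V
    isHom : IsRelHomomorphism G._∼_ H._∼_ map

K : ℕ → FiniteGraph
K n = record
  { graph    = record { V = Fin n ; _∼_ = _≢_ }
  ; ∼-sym    = λ u≢v v≡u → u≢v (sym v≡u)
  ; ∼-irrefl = λ u≡v u≢v → u≢v u≡v
  ; order    = n
  ; enum     = ↔-id (Fin n)
  }

infixr 7 _□_

_□_ : FiniteGraph → FiniteGraph → FiniteGraph
G □ H = record
  { graph    = record
    { V   = G.V × H.V
    ; _∼_ = λ (u₁ , v₁) (u₂ , v₂) →
              (u₁ G.∼ u₂ × v₁ ≡ v₂) ⊎ (u₁ ≡ u₂ × v₁ H.∼ v₂)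
    }
  ; ∼-sym    = Sum.map (λ (u∼ , v≡) → G.∼-sym u∼ , sym v≡)
                       (λ (u≡ , v∼) → sym u≡ , H.∼-sym v∼)
  ; ∼-irrefl = λ { refl (inj₁ (u∼u , _)) → G.∼-irrefl refl u∼u
                 ; refl (inj₂ (_ , v∼v)) → H.∼-irrefl refl v∼v }
  ; order    = G.order ℕ.* H.order
  ; enum     = (G.enum ×-↔ H.enum) ↔-∘ Fin.*↔×
  }
  where
  module G = FiniteGraph G
  module H = FiniteGraph H

record Measurement (H : FiniteGraph) (d : ℕ) : Set where
  open FiniteGraph H
  field
    E           : V → Matrix d
    isProjector : ∀ v → IsOrthogonalProjector (E v)
    complete    : sumᴹ (λ k → E (vertex k)) ≈ᴹ 1ᴹ

open Measurement public using (E)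

-- Taking adjoints shows that this relation is symmetric, and completeness
-- that it is loopless once d ≥ 1; the notion of homomorphism needs neither.
M : FiniteGraph → ℕ → Graph
M H d = record
  { V   = Measurement H d
  ; _∼_ = λ 𝐄 𝐄′ → ∀ v v′ → ¬ (v ∼ v′) → E 𝐄 v *ᴹ E 𝐄′ v′ ≈ᴹ 0ᴹ
  }
  where open FiniteGraph H

QuantumHom : FiniteGraph → FiniteGraph → Set
QuantumHom G H = ∃[ d ] 1 ℕ.≤ d × Hom (graph G) (M H d)

-- χq is a relation, "n is the quantum chromatic number of G", because the
-- least n cannot be computed from G constructively.
infix 4 χq_≐_

χq_≐_ : FiniteGraph → ℕ → Set
χq G ≐ n = QuantumHom G (K n) × (∀ k → QuantumHom G (K k) → n ℕ.≤ k)

{-# OPTIONS --safe #-}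
-- A quantum homomorphism from G □ H to K N restricts to the fibres, which gives
-- the lower bound.  For the upper bound, padding with zero projectors moves both
-- given homomorphisms to K N with N = m ⊔ n; if P and Q are then the measurements
-- at u and v, the one at (u , v) consists of the projectors
--   F k = Σᵢ Pᵢ ⊗ Q₍ₖ₊ᵢ₎   (indices modulo N),
-- a quantum version of colouring (u , v) by the difference of the colours of v
-- and u.  That F is a measurement, and that adjacent vertices receive disjoint
-- ones, rests on the mutual orthogonality of the projectors of a measurement,
-- which follows from the positivity of Σ ∣zᵢ∣² over ℂ.
module Submission where

open import Defs
open import Algebra.Bundles using (CommutativeMonoid; CommutativeRing)
import Algebra.Consequences.Setoid as Consequences
open import Algebra.Definitions using (Congruent₂; Commutative)
import Algebra.Properties.AbelianGroup as AbelianGroupProperties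
import Algebra.Properties.CommutativeMonoid.Sum as MonoidSum
import Algebra.Properties.CommutativeSemigroup as CommutativeSemigroupProperties
import Algebra.Properties.Group as GroupProperties
import Algebra.Properties.Ring as RingProperties
import Algebra.Properties.Semiring.Sum as SemiringSum
open import Algebra.Structures using (IsCommutativeRing)
open import Data.Bool.Base using (if_then_else_)
open import Data.Fin.Base
  using ( Fin; zero; suc; toℕ; fromℕ<; _↑ˡ_; _↑ʳ_; combine; quotient; remainder; remQuot
        ; punchIn; punchOut )
open import Data.Fin.Permutation using (Permutation′; permutation; _⟨$⟩ʳ_)
import Data.Fin.Properties as Fin
open import Data.Nat.Base as ℕ using (ℕ; _⊔_; _≤′_; ≤′-refl; ≤′-step)
open import Data.Nat.DivMod
  using (_%_; m%n<n; %-distribˡ-+; m%n%n≡m%n; [m+n]%n≡m%n; m<n⇒m%n≡m)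
import Data.Nat.Properties as ℕ
open import Data.Product.Base using (_×_; _,_; ∃-syntax)
open import Data.Rational.Base as ℚ using (ℚ; 0ℚ; 1ℚ; ½; ∣_∣)
import Data.Rational.Properties as ℚ
open import Data.Sum.Base using (inj₁; inj₂; [_,_]′)
open import Data.Vec.Functional using (Vector; removeAt)
open import Function.Base using (_∘_)
open import Function.Bundles using (Inverse)
open import Level using (0ℓ)
open import Relation.Binary.Bundles using (Setoid)
open import Relation.Binary.Morphism.Structures using (IsRelHomomorphism)
import Relation.Binary.PropositionalEquality as ≡
open ≡ using (_≡_; _≢_)
open import Relation.Binary.Structures using (IsEquivalence)
open import Relation.Nullary.Decidable using (⌊_⌋; Dec; yes; no; decidable-stable)
open import Relation.Nullary.Negation using (contradiction)

-- Modular addition as a symmetric family of permutations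

-- The amount is a natural number because the inverse of the shift by `toℕ k` is the shift by
-- `N ∸ toℕ k`, which for `k = zero` is `N` itself and lies outside `Fin N`.
shift : ∀ {n} → ℕ → Fin (ℕ.suc n) → Fin (ℕ.suc n)
shift {n} s i = fromℕ< (m%n<n (toℕ i ℕ.+ s) (ℕ.suc n))

toℕ-shift : ∀ {n} s (i : Fin (ℕ.suc n)) → toℕ (shift s i) ≡ (toℕ i ℕ.+ s) % ℕ.suc n
toℕ-shift s i = Fin.toℕ-fromℕ< _

-- The intermediate reduction modulo `N` does not affect the final remainder, and the two additions
-- together make one full turn.
shift-shift : ∀ {n} s t → s ℕ.+ t ≡ ℕ.suc n → (i : Fin (ℕ.suc n)) → shift t (shift s i) ≡ i
shift-shift {n} s t s+t≡N i = Fin.toℕ-injective (begin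
  toℕ (shift t (shift s i))                  ≡⟨ toℕ-shift t (shift s i) ⟩
  (toℕ (shift s i) ℕ.+ t) % N                ≡⟨ ≡.cong (λ x → (x ℕ.+ t) % N) (toℕ-shift s i) ⟩
  ((toℕ i ℕ.+ s) % N ℕ.+ t) % N              ≡⟨ %-distribˡ-+ ((toℕ i ℕ.+ s) % N) t N ⟩
  ((toℕ i ℕ.+ s) % N % N ℕ.+ t % N) % N      ≡⟨ ≡.cong (λ x → (x ℕ.+ t % N) % N) (m%n%n≡m%n (toℕ i ℕ.+ s) N) ⟩
  ((toℕ i ℕ.+ s) % N ℕ.+ t % N) % N          ≡⟨ %-distribˡ-+ (toℕ i ℕ.+ s) t N ⟨
  (toℕ i ℕ.+ s ℕ.+ t) % N                    ≡⟨ ≡.cong (_% N) (ℕ.+-assoc (toℕ i) s t) ⟩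
  (toℕ i ℕ.+ (s ℕ.+ t)) % N                  ≡⟨ ≡.cong (λ x → (toℕ i ℕ.+ x) % N) s+t≡N ⟩
  (toℕ i ℕ.+ N) % N                          ≡⟨ [m+n]%n≡m%n (toℕ i) N ⟩
  toℕ i % N                                  ≡⟨ m<n⇒m%n≡m (Fin.toℕ<n i) ⟩
  toℕ i                                      ∎)
  where
  open ≡.≡-Reasoning
  N = ℕ.suc n

rotate : ∀ {N} → Fin N → Permutation′ N
rotate {N@(ℕ.suc _)} k = permutation (shift (toℕ k)) (shift (N ℕ.∸ toℕ k))
  (shift-shift (N ℕ.∸ toℕ k) (toℕ k) (ℕ.m∸n+n≡m k≤N))
  (shift-shift (toℕ k) (N ℕ.∸ toℕ k) (ℕ.m+[n∸m]≡n k≤N))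
  where k≤N = ℕ.<⇒≤ (Fin.toℕ<n k)

-- Lets a sum over `k` of terms in `rotate k ⟨$⟩ʳ i`, with `i` fixed, be read as a sum reindexed
-- along the single permutation `rotate i`.
rotate-comm : ∀ {N} (k i : Fin N) → rotate k ⟨$⟩ʳ i ≡ rotate i ⟨$⟩ʳ k
rotate-comm {N@(ℕ.suc _)} k i = Fin.toℕ-injective (begin
  toℕ (shift (toℕ k) i)    ≡⟨ toℕ-shift (toℕ k) i ⟩
  (toℕ i ℕ.+ toℕ k) % N    ≡⟨ ≡.cong (_% N) (ℕ.+-comm (toℕ i) (toℕ k)) ⟩
  (toℕ k ℕ.+ toℕ i) % N    ≡⟨ toℕ-shift (toℕ i) k ⟨
  toℕ (shift (toℕ i) k)    ∎)
  where open ≡.≡-Reasoning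

rotate-injective : ∀ {N} (k : Fin N) {i j} → rotate k ⟨$⟩ʳ i ≡ rotate k ⟨$⟩ʳ j → i ≡ j
rotate-injective {N} k {i} {j} eq = begin
  i                                                ≡⟨ Inverse.strictlyInverseʳ (rotate k) i ⟨
  Inverse.from (rotate k) (rotate k ⟨$⟩ʳ i)        ≡⟨ ≡.cong (Inverse.from (rotate k)) eq ⟩
  Inverse.from (rotate k) (rotate k ⟨$⟩ʳ j)        ≡⟨ Inverse.strictlyInverseʳ (rotate k) j ⟩
  j                                                ∎
  where open ≡.≡-Reasoning

-- Finite sums in a commutative monoid

module SumProperties {c ℓ} (M : CommutativeMonoid c ℓ) where
  open CommutativeMonoid M renaming (_∙_ to _+_; ε to 0#)
  open MonoidSum M
  open import Relation.Binary.Reasoning.Setoid setoid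

  sum-zero : ∀ {n} {f : Vector Carrier n} → (∀ i → f i ≈ 0#) → sum f ≈ 0#
  sum-zero {n} f≈0 = trans (sum-cong-≋ f≈0) (sum-replicate-zero n)

  sum-single : ∀ {n} (f : Vector Carrier n) i → (∀ j → j ≢ i → f j ≈ 0#) → sum f ≈ f i
  sum-single {ℕ.suc n} f i f≈0 = begin
    sum f                    ≈⟨ sum-remove f ⟩
    f i + sum (removeAt f i) ≈⟨ ∙-congˡ (sum-zero (λ j → f≈0 (punchIn i j) (Fin.punchInᵢ≢i i j))) ⟩
    f i + 0#                 ≈⟨ identityʳ (f i) ⟩
    f i                      ∎

  sum-+ : ∀ m {n} (f : Vector Carrier (m ℕ.+ n)) →
          sum f ≈ sum (λ i → f (i ↑ˡ n)) + sum (λ j → f (m ↑ʳ j))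
  sum-+ ℕ.zero    f = sym (identityˡ _)
  sum-+ (ℕ.suc m) f = trans (∙-congˡ (sum-+ m (f ∘ suc))) (sym (assoc _ _ _))

  -- Serves the Kronecker product, whose rows and columns are indexed by pairs encoded in
  -- `Fin (m ℕ.* n)`.
  sum-combine : ∀ m n (f : Vector Carrier (m ℕ.* n)) →
                sum f ≈ ∑[ i < m ] ∑[ j < n ] f (combine i j)
  sum-combine ℕ.zero    n f = refl
  sum-combine (ℕ.suc m) n f = trans (sum-+ n f) (∙-congˡ (sum-combine m n (f ∘ (n ↑ʳ_))))

-- Matrices over a ring with a positive definite conjugation

-- The properties of complex conjugation behind positivity: `nonNeg-⋆*`, `nonNeg-+-zeroˡ` and
-- `⋆*-definite` together make every `x` vanish in a vanishing sum of terms `x ⋆ * x`.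
record PositiveConjugation {c ℓ} (R : CommutativeRing c ℓ) p :
       Set (c Level.⊔ ℓ Level.⊔ Level.suc p) where
  open CommutativeRing R
  infix 8 _⋆
  field
    _⋆             : Carrier → Carrier
    ⋆-cong         : ∀ {x y} → x ≈ y → x ⋆ ≈ y ⋆
    ⋆-+            : ∀ x y → (x + y) ⋆ ≈ x ⋆ + y ⋆
    ⋆-*            : ∀ x y → (x * y) ⋆ ≈ x ⋆ * y ⋆
    ⋆-0            : 0# ⋆ ≈ 0#
    NonNeg         : Carrier → Set p
    nonNeg-0       : NonNeg 0#
    nonNeg-+       : ∀ {x y} → NonNeg x → NonNeg y → NonNeg (x + y)
    nonNeg-+-zeroˡ : ∀ {x y} → NonNeg x → NonNeg y → x + y ≈ 0# → x ≈ 0#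
    nonNeg-⋆*      : ∀ x → NonNeg (x ⋆ * x)
    ⋆*-definite    : ∀ x → x ⋆ * x ≈ 0# → x ≈ 0#

module MatrixAlgebra {c ℓ p} (R : CommutativeRing c ℓ) (P : PositiveConjugation R p) where
  open CommutativeRing R hiding (zero)
  open PositiveConjugation P
  open SemiringSum semiring
  open SumProperties +-commutativeMonoid
  open CommutativeSemigroupProperties *-commutativeSemigroup using (interchange)
  open GroupProperties +-group using (identityʳ-unique)
  open import Relation.Binary.Reasoning.Setoid setoid

  Mat : ℕ → Set c
  Mat d = Fin d → Fin d → Carrier

  infix  4 _≈ₘ_
  infixl 7 _·_ _⊗_
  infix  8 _†ₘ

  _≈ₘ_ : ∀ {d} → Mat d → Mat d → Set ℓ
  A ≈ₘ B = ∀ x y → A x y ≈ B x y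

  0ₘ 1ₘ : ∀ {d} → Mat d
  0ₘ _ _ = 0#
  1ₘ x y = if ⌊ x Fin.≟ y ⌋ then 1# else 0#

  _·_ : ∀ {d} → Mat d → Mat d → Mat d
  (A · B) x y = sum (λ k → A x k * B k y)

  _†ₘ : ∀ {d} → Mat d → Mat d
  (A †ₘ) x y = (A y x) ⋆

  sumₘ : ∀ {n d} → Vector (Mat d) n → Mat d
  sumₘ As x y = sum (λ k → As k x y)

  ≈ₘ-sym : ∀ {d} {A B : Mat d} → A ≈ₘ B → B ≈ₘ A
  ≈ₘ-sym A≈B x y = sym (A≈B x y)

  ≈ₘ-trans : ∀ {d} {A B C : Mat d} → A ≈ₘ B → B ≈ₘ C → A ≈ₘ C
  ≈ₘ-trans A≈B B≈C x y = trans (A≈B x y) (B≈C x y)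

  1ₘ-diag : ∀ {d} (x : Fin d) → 1ₘ x x ≈ 1#
  1ₘ-diag x with x Fin.≟ x
  ... | yes _  = refl
  ... | no x≢x = contradiction ≡.refl x≢x

  1ₘ-off : ∀ {d} {x y : Fin d} → x ≢ y → 1ₘ x y ≈ 0#
  1ₘ-off {x = x} {y} x≢y with x Fin.≟ y
  ... | yes x≡y = contradiction x≡y x≢y
  ... | no _    = refl

  ·-cong : ∀ {d} {A A′ B B′ : Mat d} → A ≈ₘ A′ → B ≈ₘ B′ → A · B ≈ₘ A′ · B′
  ·-cong A≈ B≈ x y = sum-cong-≋ (λ k → *-cong (A≈ x k) (B≈ k y))

  ·-zeroˡ : ∀ {d} {A : Mat d} (B : Mat d) → A ≈ₘ 0ₘ → A · B ≈ₘ 0ₘ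
  ·-zeroˡ B A≈0 x y = sum-zero (λ k → trans (*-congʳ (A≈0 x k)) (zeroˡ _))

  ·-identityˡ : ∀ {d} (A : Mat d) → 1ₘ · A ≈ₘ A
  ·-identityˡ A x y = begin
    sum (λ k → 1ₘ x k * A k y)
      ≈⟨ sum-single _ x (λ k k≢x → trans (*-congʳ (1ₘ-off (k≢x ∘ ≡.sym))) (zeroˡ _)) ⟩
    1ₘ x x * A x y              ≈⟨ *-congʳ (1ₘ-diag x) ⟩
    1# * A x y                  ≈⟨ *-identityˡ _ ⟩
    A x y                       ∎

  ·-assoc : ∀ {d} (A B C : Mat d) → (A · B) · C ≈ₘ A · (B · C)
  ·-assoc A B C x y = begin
    sum (λ k → sum (λ l → A x l * B l k) * C k y)
      ≈⟨ sum-cong-≋ (λ k → *-distribʳ-sum (C k y) (λ l → A x l * B l k)) ⟩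
    sum (λ k → sum (λ l → A x l * B l k * C k y))
      ≈⟨ ∑-comm (λ k l → A x l * B l k * C k y) ⟩
    sum (λ l → sum (λ k → A x l * B l k * C k y))
      ≈⟨ sum-cong-≋ (λ l → sum-cong-≋ (λ k → *-assoc (A x l) (B l k) (C k y))) ⟩
    sum (λ l → sum (λ k → A x l * (B l k * C k y)))
      ≈⟨ sum-cong-≋ (λ l → *-distribˡ-sum (A x l) (λ k → B l k * C k y)) ⟨
    sum (λ l → A x l * sum (λ k → B l k * C k y)) ∎

  ·-sumˡ : ∀ {n d} (As : Vector (Mat d) n) B → sumₘ As · B ≈ₘ sumₘ (λ i → As i · B)
  ·-sumˡ As B x y = trans (sum-cong-≋ (λ k → *-distribʳ-sum (B k y) (λ i → As i x k)))
                          (∑-comm (λ k i → As i x k * B k y))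

  ·-sumʳ : ∀ {n d} A (Bs : Vector (Mat d) n) → A · sumₘ Bs ≈ₘ sumₘ (λ i → A · Bs i)
  ·-sumʳ A Bs x y = trans (sum-cong-≋ (λ k → *-distribˡ-sum (A x k) (λ i → Bs i k y)))
                          (∑-comm (λ k i → A x k * Bs i k y))

  ⋆-sum : ∀ {n} (f : Vector Carrier n) → (sum f) ⋆ ≈ sum (λ i → f i ⋆)
  ⋆-sum {ℕ.zero}  f = ⋆-0
  ⋆-sum {ℕ.suc n} f = trans (⋆-+ _ _) (+-congˡ (⋆-sum (f ∘ suc)))

  †-· : ∀ {d} (A B : Mat d) → (A · B) †ₘ ≈ₘ B †ₘ · A †ₘ
  †-· A B x y = trans (⋆-sum (λ k → A y k * B k x))
    (sum-cong-≋ (λ k → trans (⋆-* (A y k) (B k x)) (*-comm _ _)))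

  nonNeg-sum : ∀ {n} {f : Vector Carrier n} → (∀ i → NonNeg (f i)) → NonNeg (sum f)
  nonNeg-sum {ℕ.zero}  f≥0 = nonNeg-0
  nonNeg-sum {ℕ.suc n} f≥0 = nonNeg-+ (f≥0 zero) (nonNeg-sum (f≥0 ∘ suc))

  nonNeg-sum-zero : ∀ {n} {f : Vector Carrier n} → (∀ i → NonNeg (f i)) →
                    sum f ≈ 0# → ∀ i → f i ≈ 0#
  nonNeg-sum-zero f≥0 Σf≈0 zero =
    nonNeg-+-zeroˡ (f≥0 zero) (nonNeg-sum (f≥0 ∘ suc)) Σf≈0
  -- The sum is commuted so that the tail becomes the first summand and vanishes as a whole; the
  -- recursion then treats its terms.
  nonNeg-sum-zero f≥0 Σf≈0 (suc i) = nonNeg-sum-zero (f≥0 ∘ suc)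
    (nonNeg-+-zeroˡ (nonNeg-sum (f≥0 ∘ suc)) (f≥0 zero) (trans (+-comm _ _) Σf≈0)) i

  -- Cancelling `f j` leaves a sum of nonnegative terms equal to zero, and `f i` is one of them.
  nonNeg-sum-single : ∀ {n} {f : Vector Carrier n} → (∀ i → NonNeg (f i)) →
                      ∀ {j} → sum f ≈ f j → ∀ {i} → i ≢ j → f i ≈ 0#
  nonNeg-sum-single {ℕ.suc n} {f} f≥0 {j} Σf≈fj {i} i≢j =
    ≡.subst (λ k → f k ≈ 0#) (Fin.punchIn-punchOut (i≢j ∘ ≡.sym))
      (nonNeg-sum-zero (f≥0 ∘ punchIn j) rest≈0 (punchOut (i≢j ∘ ≡.sym)))
    where
    rest≈0 : sum (removeAt f j) ≈ 0#
    rest≈0 = identityʳ-unique (f j) _ (trans (sym (sum-remove f)) Σf≈fj)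

  record IsProjector {d} (E : Mat d) : Set ℓ where
    field
      selfAdjoint : E †ₘ ≈ₘ E
      idempotent  : E · E ≈ₘ E

  -- A projection-valued measure with outcomes in `Fin N`. Mutual orthogonality is not a field; it
  -- is derived in `pvm-orthogonal`.
  record IsPVM {N d} (E : Vector (Mat d) N) : Set ℓ where
    field
      isProjector : ∀ k → IsProjector (E k)
      complete    : sumₘ E ≈ₘ 1ₘ
    open module Proj k = IsProjector (isProjector k) public

  -- Compressing Σᵢ Eᵢ = 1 by Eⱼ gives Σᵢ (Eᵢ Eⱼ)† (Eᵢ Eⱼ) = Eⱼ, whose j-th
  -- summand is already Eⱼ.  The other summands have diagonals that are sums of
  -- squared moduli of entries of Eᵢ Eⱼ, and these must vanish.
  pvm-orthogonal : ∀ {N d} {E : Vector (Mat d) N} → IsPVM E →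
                   ∀ {i j} → i ≢ j → E i · E j ≈ₘ 0ₘ
  pvm-orthogonal {N} {d} {E} isPVM {i} {j} i≢j x y =
    ⋆*-definite _ (nonNeg-sum-zero (λ k → nonNeg-⋆* _) gram≈0 x)
    where
    open IsPVM isPVM
    gram : Fin N → Mat d
    gram k = (E k · E j) †ₘ · (E k · E j)

    gram≈ : ∀ k → gram k ≈ₘ E j · (E k · E j)
    gram≈ k =
      ≈ₘ-trans (·-cong (≈ₘ-trans (†-· (E k) (E j)) (·-cong (selfAdjoint j) (selfAdjoint k)))
                       (λ _ _ → refl))
      (≈ₘ-trans (·-assoc (E j) (E k) (E k · E j))
      (·-cong (λ _ _ → refl) (≈ₘ-trans (≈ₘ-sym (·-assoc (E k) (E k) (E j)))
                                       (·-cong (idempotent k) (λ _ _ → refl)))))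

    sum-gram : sumₘ gram ≈ₘ E j
    sum-gram =
      ≈ₘ-trans (λ a b → sum-cong-≋ (λ k → gram≈ k a b))
      (≈ₘ-trans (≈ₘ-sym (·-sumʳ (E j) (λ k → E k · E j)))
      (≈ₘ-trans (·-cong (λ _ _ → refl) (≈ₘ-trans (≈ₘ-sym (·-sumˡ E (E j)))
                  (≈ₘ-trans (·-cong complete (λ _ _ → refl)) (·-identityˡ (E j)))))
      (idempotent j)))

    gram-j : gram j ≈ₘ E j
    gram-j = ≈ₘ-trans (gram≈ j)
      (≈ₘ-trans (·-cong (λ _ _ → refl) (idempotent j)) (idempotent j))

    gram≈0 : gram i y y ≈ 0#
    gram≈0 = nonNeg-sum-single (λ k → nonNeg-sum (λ r → nonNeg-⋆* ((E k · E j) r y)))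
      (trans (sum-gram y y) (sym (gram-j y y))) i≢j

  -- Kronecker products

  _⊗_ : ∀ {d e} → Mat d → Mat e → Mat (d ℕ.* e)
  _⊗_ {d} {e} A B x y = A (quotient e x) (quotient e y) * B (remainder {d} e x) (remainder {d} e y)

  ⊗-cong : ∀ {d e} {A A′ : Mat d} {B B′ : Mat e} → A ≈ₘ A′ → B ≈ₘ B′ → A ⊗ B ≈ₘ A′ ⊗ B′
  ⊗-cong A≈ B≈ x y = *-cong (A≈ _ _) (B≈ _ _)

  ⊗-zeroˡ : ∀ {d e} {A : Mat d} (B : Mat e) → A ≈ₘ 0ₘ → A ⊗ B ≈ₘ 0ₘ
  ⊗-zeroˡ B A≈0 x y = trans (*-congʳ (A≈0 _ _)) (zeroˡ _)

  ⊗-zeroʳ : ∀ {d e} (A : Mat d) {B : Mat e} → B ≈ₘ 0ₘ → A ⊗ B ≈ₘ 0ₘ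
  ⊗-zeroʳ A B≈0 x y = trans (*-congˡ (B≈0 _ _)) (zeroʳ _)

  sum-*-sum : ∀ {m n} (f : Vector Carrier m) (g : Vector Carrier n) →
              sum f * sum g ≈ ∑[ i < m ] ∑[ j < n ] (f i * g j)
  sum-*-sum f g = trans (*-distribʳ-sum (sum g) f) (sum-cong-≋ (λ i → *-distribˡ-sum (f i) g))

  -- The mixed-product property: once the summation index is split into a pair, the entry is a
  -- double sum that factors into a sum over each component.
  ⊗-· : ∀ {d e} (A C : Mat d) (B D : Mat e) → (A ⊗ B) · (C ⊗ D) ≈ₘ (A · C) ⊗ (B · D)
  ⊗-· {d} {e} A C B D x y = begin
    sum (λ k → A x₁ (quotient e k) * B x₂ (remainder {d} e k) *
               (C (quotient e k) y₁ * D (remainder {d} e k) y₂))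
      ≈⟨ sum-combine d e _ ⟩
    (∑[ i < d ] ∑[ j < e ] term (remQuot {d} e (combine i j)))
      ≈⟨ sum-cong-≋ (λ i → sum-cong-≋ (λ j →
           trans (reflexive (≡.cong term (Fin.remQuot-combine i j))) (interchange _ _ _ _))) ⟩
    (∑[ i < d ] ∑[ j < e ] (A x₁ i * C i y₁ * (B x₂ j * D j y₂)))
      ≈⟨ sum-*-sum (λ i → A x₁ i * C i y₁) (λ j → B x₂ j * D j y₂) ⟨
    sum (λ i → A x₁ i * C i y₁) * sum (λ j → B x₂ j * D j y₂) ∎
    where
    x₁ = quotient e x
    x₂ = remainder {d} e x
    y₁ = quotient e y
    y₂ = remainder {d} e y
    term : Fin d × Fin e → Carrier
    term (i , j) = A x₁ i * B x₂ j * (C i y₁ * D j y₂)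

  ⊗-† : ∀ {d e} (A : Mat d) (B : Mat e) → (A ⊗ B) †ₘ ≈ₘ A †ₘ ⊗ B †ₘ
  ⊗-† A B x y = ⋆-* _ _

  -- Two distinct indices differ in quotient or remainder, so one of the two factors is an
  -- off-diagonal entry of an identity matrix.
  1⊗1 : ∀ {d e} → 1ₘ {d} ⊗ 1ₘ {e} ≈ₘ 1ₘ
  1⊗1 {d} {e} x y with x Fin.≟ y
  ... | yes ≡.refl = trans (*-cong (1ₘ-diag (quotient e x)) (1ₘ-diag (remainder {d} e x))) (*-identityˡ 1#)
  ... | no x≢y with quotient {d} e x Fin.≟ quotient e y
  ...   | no _ = zeroˡ _
  ...   | yes q≡ = trans (*-congˡ (1ₘ-off r≢)) (zeroʳ _)
    where
    r≢ : remainder {d} e x ≢ remainder {d} e y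
    r≢ r≡ = x≢y (≡.trans (≡.sym (Fin.combine-remQuot {d} e x))
            (≡.trans (≡.cong₂ combine q≡ r≡) (Fin.combine-remQuot {d} e y)))

  -- Combining two measurements by the difference of their outcomes

  infixl 7 _⊛_

  -- A coarse-graining of the product measurement: the pair of outcomes `(i , j)` is counted under
  -- the one `k` that is `j - i` modulo `N`.
  _⊛_ : ∀ {N d e} → Vector (Mat d) N → Vector (Mat e) N → Vector (Mat (d ℕ.* e)) N
  (P ⊛ Q) k = sumₘ (λ i → P i ⊗ Q (rotate k ⟨$⟩ʳ i))

  -- Four independent families are allowed so that idempotence and both disjointness lemmas become
  -- instances of one expansion.
  ⊛-· : ∀ {N d e} (P P′ : Vector (Mat d) N) (Q Q′ : Vector (Mat e) N) k →
        (P ⊛ Q) k · (P′ ⊛ Q′) k ≈ₘ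
        sumₘ (λ i → sumₘ (λ j → (P i · P′ j) ⊗ (Q (rotate k ⟨$⟩ʳ i) · Q′ (rotate k ⟨$⟩ʳ j))))
  ⊛-· P P′ Q Q′ k x y = begin
    ((P ⊛ Q) k · (P′ ⊛ Q′) k) x y
      ≈⟨ ·-sumˡ (λ i → P i ⊗ Q (rotate k ⟨$⟩ʳ i)) ((P′ ⊛ Q′) k) x y ⟩
    sum (λ i → ((P i ⊗ Q (rotate k ⟨$⟩ʳ i)) · (P′ ⊛ Q′) k) x y)
      ≈⟨ sum-cong-≋ (λ i → ·-sumʳ (P i ⊗ Q (rotate k ⟨$⟩ʳ i))
                                  (λ j → P′ j ⊗ Q′ (rotate k ⟨$⟩ʳ j)) x y) ⟩
    sum (λ i → sum (λ j → ((P i ⊗ Q (rotate k ⟨$⟩ʳ i)) · (P′ j ⊗ Q′ (rotate k ⟨$⟩ʳ j))) x y))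
      ≈⟨ sum-cong-≋ (λ i → sum-cong-≋ (λ j →
           ⊗-· (P i) (P′ j) (Q (rotate k ⟨$⟩ʳ i)) (Q′ (rotate k ⟨$⟩ʳ j)) x y)) ⟩
    sum (λ i → sum (λ j → ((P i · P′ j) ⊗ (Q (rotate k ⟨$⟩ʳ i) · Q′ (rotate k ⟨$⟩ʳ j))) x y)) ∎

  ⊛-selfAdjoint : ∀ {N d e} (P : Vector (Mat d) N) (Q : Vector (Mat e) N) →
                  (∀ i → P i †ₘ ≈ₘ P i) → (∀ i → Q i †ₘ ≈ₘ Q i) →
                  ∀ k → (P ⊛ Q) k †ₘ ≈ₘ (P ⊛ Q) k
  ⊛-selfAdjoint P Q P†≈P Q†≈Q k x y = trans (⋆-sum (λ i → (P i ⊗ Q (rotate k ⟨$⟩ʳ i)) y x)) (sum-cong-≋ (λ i →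
    trans (⊗-† (P i) (Q (rotate k ⟨$⟩ʳ i)) x y) (⊗-cong (P†≈P i) (Q†≈Q _) x y)))

  -- In the square of `(P ⊛ Q) k` the cross terms vanish by orthogonality of `P`, and the remaining
  -- ones are idempotent. For completeness, with `i` fixed the index of `Q` runs through all
  -- outcomes as `k` does, so the total is the product of the two complete sums.
  ⊛-isPVM : ∀ {N d e} {P : Vector (Mat d) N} {Q : Vector (Mat e) N} →
            IsPVM P → IsPVM Q → IsPVM (P ⊛ Q)
  ⊛-isPVM {N} {d} {e} {P} {Q} isP isQ = record
    { isProjector = λ k → record
      { selfAdjoint = ⊛-selfAdjoint P Q P.selfAdjoint Q.selfAdjoint k
      ; idempotent  = λ x y → trans (⊛-· P P Q Q k x y)
          (sum-cong-≋ (λ i → trans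
            (sum-single _ i (λ j j≢i →
              ⊗-zeroˡ (Q (rotate k ⟨$⟩ʳ i) · Q (rotate k ⟨$⟩ʳ j))
                  (pvm-orthogonal isP (j≢i ∘ ≡.sym)) x y))
            (⊗-cong (P.idempotent i) (Q.idempotent _) x y)))
      }
    ; complete = complete
    }
    where
    module P = IsPVM isP
    module Q = IsPVM isQ
    complete : sumₘ (P ⊛ Q) ≈ₘ 1ₘ
    complete x y = begin
      (∑[ k < N ] ∑[ i < N ] (P i x₁ y₁ * Q (rotate k ⟨$⟩ʳ i) x₂ y₂))
        ≈⟨ ∑-comm (λ k i → P i x₁ y₁ * Q (rotate k ⟨$⟩ʳ i) x₂ y₂) ⟩
      (∑[ i < N ] ∑[ k < N ] (P i x₁ y₁ * Q (rotate k ⟨$⟩ʳ i) x₂ y₂))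
        ≈⟨ sum-cong-≋ (λ i → *-distribˡ-sum (P i x₁ y₁) (λ k → Q (rotate k ⟨$⟩ʳ i) x₂ y₂)) ⟨
      (∑[ i < N ] (P i x₁ y₁ * (∑[ k < N ] Q (rotate k ⟨$⟩ʳ i) x₂ y₂)))
        ≈⟨ sum-cong-≋ (λ i → *-congˡ (sum-cong-≋ (λ k →
             reflexive (≡.cong (λ j → Q j x₂ y₂) (rotate-comm k i))))) ⟩
      (∑[ i < N ] (P i x₁ y₁ * (∑[ k < N ] Q (rotate i ⟨$⟩ʳ k) x₂ y₂)))
        ≈⟨ sum-cong-≋ (λ i → *-congˡ (∑-permute (λ j → Q j x₂ y₂) (rotate i))) ⟨
      (∑[ i < N ] (P i x₁ y₁ * (∑[ j < N ] Q j x₂ y₂)))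
        -- A product of an entry of `sumₘ P` and an entry of `sumₘ Q` is by definition an entry of
        -- their Kronecker product.
        ≈⟨ *-distribʳ-sum (∑[ j < N ] Q j x₂ y₂) (λ i → P i x₁ y₁) ⟨
      (sumₘ P ⊗ sumₘ Q) x y
        ≈⟨ ⊗-cong P.complete Q.complete x y ⟩
      (1ₘ {d} ⊗ 1ₘ {e}) x y
        ≈⟨ 1⊗1 {d} {e} x y ⟩
      1ₘ x y ∎
      where
      x₁ = quotient e x
      x₂ = remainder {d} e x
      y₁ = quotient e y
      y₂ = remainder {d} e y

  -- The terms with `i ≡ j` vanish by the hypothesis on `P` and `P′`. For `i ≢ j` the rotated
  -- indices differ as well, and orthogonality of the common `Q` applies.
  ⊛-disjointˡ : ∀ {N d e} {P P′ : Vector (Mat d) N} {Q : Vector (Mat e) N} → IsPVM Q →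
                (∀ i → P i · P′ i ≈ₘ 0ₘ) → ∀ k → (P ⊛ Q) k · (P′ ⊛ Q) k ≈ₘ 0ₘ
  ⊛-disjointˡ {N} {d} {e} {P} {P′} {Q} isQ PP′≈0 k x y =
    trans (⊛-· P P′ Q Q k x y) (sum-zero (λ i → sum-zero (λ j → term≈0 i j (i Fin.≟ j))))
    where
    term≈0 : ∀ i j → Dec (i ≡ j) →
             ((P i · P′ j) ⊗ (Q (rotate k ⟨$⟩ʳ i) · Q (rotate k ⟨$⟩ʳ j))) x y ≈ 0#
    term≈0 i .i (yes ≡.refl) = ⊗-zeroˡ (Q (rotate k ⟨$⟩ʳ i) · Q (rotate k ⟨$⟩ʳ i)) (PP′≈0 i) x y
    term≈0 i j  (no i≢j)     =
      ⊗-zeroʳ (P i · P′ j) (pvm-orthogonal isQ (i≢j ∘ rotate-injective k)) x y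

  -- Here the roles are exchanged: `Q` and `Q′` kill the terms with `i ≡ j`, and orthogonality of
  -- the common `P` kills the others.
  ⊛-disjointʳ : ∀ {N d e} {P : Vector (Mat d) N} {Q Q′ : Vector (Mat e) N} → IsPVM P →
                (∀ i → Q i · Q′ i ≈ₘ 0ₘ) → ∀ k → (P ⊛ Q) k · (P ⊛ Q′) k ≈ₘ 0ₘ
  ⊛-disjointʳ {N} {d} {e} {P} {Q} {Q′} isP QQ′≈0 k x y =
    trans (⊛-· P P Q Q′ k x y) (sum-zero (λ i → sum-zero (λ j → term≈0 i j (i Fin.≟ j))))
    where
    term≈0 : ∀ i j → Dec (i ≡ j) →
             ((P i · P j) ⊗ (Q (rotate k ⟨$⟩ʳ i) · Q′ (rotate k ⟨$⟩ʳ j))) x y ≈ 0#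
    term≈0 i .i (yes ≡.refl) = ⊗-zeroʳ (P i · P i) (QQ′≈0 (rotate k ⟨$⟩ʳ i)) x y
    term≈0 i j  (no i≢j)     =
      ⊗-zeroˡ (Q (rotate k ⟨$⟩ʳ i) · Q′ (rotate k ⟨$⟩ʳ j)) (pvm-orthogonal isP i≢j) x y

-- The ring of complex numbers

-- The letters `a b`, `c d`, `e f` are the real and imaginary parts of up to three complex numbers;
-- the prefixes `re` and `im` mark the two components of one complex law.
module ComplexIdentities {c ℓ} (R : CommutativeRing c ℓ) where
  open CommutativeRing R
  open RingProperties ring
    using (x[y-z]≈xy-xz; [y-z]x≈yx-zx; -‿distribˡ-*; -‿distribʳ-*; -‿involutive; -0#≈0#)
  open AbelianGroupProperties +-abelianGroup using (⁻¹-∙-comm)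
  open CommutativeSemigroupProperties +-commutativeSemigroup using (interchange)
  open DifferenceIdentities R using ([a-c]+[b-d]≈[a+b]-[c+d])
  open import Relation.Binary.Reasoning.Setoid setoid

  [a-b]-[c+d]≈[a-c]-[d+b] : ∀ a b c d → (a - b) - (c + d) ≈ (a - c) - (d + b)
  [a-b]-[c+d]≈[a-c]-[d+b] a b c d = begin
    (a - b) - (c + d)      ≈⟨ a-b-c≈a-[b+c] a b (c + d) ⟩
    a - (b + (c + d))      ≈⟨ +-congˡ (-‿cong (trans (+-comm b (c + d)) (+-assoc c d b))) ⟩
    a - (c + (d + b))      ≈⟨ a-b-c≈a-[b+c] a c (d + b) ⟨
    (a - c) - (d + b)      ∎
    where
    a-b-c≈a-[b+c] : ∀ a b c → (a - b) - c ≈ a - (b + c)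
    a-b-c≈a-[b+c] a b c = trans (+-assoc a (- b) (- c)) (+-congˡ (⁻¹-∙-comm b c))

  re-assoc : ∀ a b c d e f →
    (a * c - b * d) * e - (a * d + b * c) * f ≈ a * (c * e - d * f) - b * (c * f + d * e)
  re-assoc a b c d e f = begin
    (a * c - b * d) * e - (a * d + b * c) * f
      ≈⟨ +-cong ([y-z]x≈yx-zx e (a * c) (b * d)) (-‿cong (distribʳ f (a * d) (b * c))) ⟩
    (a * c * e - b * d * e) - (a * d * f + b * c * f)
      ≈⟨ [a-b]-[c+d]≈[a-c]-[d+b] (a * c * e) (b * d * e) (a * d * f) (b * c * f) ⟩
    (a * c * e - a * d * f) - (b * c * f + b * d * e)
      ≈⟨ +-cong (+-cong (*-assoc a c e) (-‿cong (*-assoc a d f)))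
                (-‿cong (+-cong (*-assoc b c f) (*-assoc b d e))) ⟩
    (a * (c * e) - a * (d * f)) - (b * (c * f) + b * (d * e))
      ≈⟨ +-cong (x[y-z]≈xy-xz a (c * e) (d * f)) (-‿cong (distribˡ b (c * f) (d * e))) ⟨
    a * (c * e - d * f) - b * (c * f + d * e) ∎

  im-assoc : ∀ a b c d e f →
    (a * c - b * d) * f + (a * d + b * c) * e ≈ a * (c * f + d * e) + b * (c * e - d * f)
  im-assoc a b c d e f = begin
    (a * c - b * d) * f + (a * d + b * c) * e
      ≈⟨ +-cong ([y-z]x≈yx-zx f (a * c) (b * d)) (distribʳ e (a * d) (b * c)) ⟩
    (a * c * f - b * d * f) + (a * d * e + b * c * e)
      ≈⟨ interchange (a * c * f) (- (b * d * f)) (a * d * e) (b * c * e) ⟩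
    (a * c * f + a * d * e) + (- (b * d * f) + b * c * e)
      ≈⟨ +-congˡ (+-comm (- (b * d * f)) (b * c * e)) ⟩
    (a * c * f + a * d * e) + (b * c * e - b * d * f)
      ≈⟨ +-cong (+-cong (*-assoc a c f) (*-assoc a d e))
                (+-cong (*-assoc b c e) (-‿cong (*-assoc b d f))) ⟩
    (a * (c * f) + a * (d * e)) + (b * (c * e) - b * (d * f))
      ≈⟨ +-cong (distribˡ a (c * f) (d * e)) (x[y-z]≈xy-xz b (c * e) (d * f)) ⟨
    a * (c * f + d * e) + b * (c * e - d * f) ∎

  re-comm : ∀ a b c d → a * c - b * d ≈ c * a - d * b
  re-comm a b c d = +-cong (*-comm a c) (-‿cong (*-comm b d))

  im-comm : ∀ a b c d → a * d + b * c ≈ c * b + d * a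
  im-comm a b c d = trans (+-comm (a * d) (b * c)) (+-cong (*-comm b c) (*-comm a d))

  re-distribˡ : ∀ a b c d e f →
    a * (c + e) - b * (d + f) ≈ (a * c - b * d) + (a * e - b * f)
  re-distribˡ a b c d e f = begin
    a * (c + e) - b * (d + f)
      ≈⟨ +-cong (distribˡ a c e) (-‿cong (distribˡ b d f)) ⟩
    (a * c + a * e) - (b * d + b * f)
      ≈⟨ [a-c]+[b-d]≈[a+b]-[c+d] (a * c) (a * e) (b * d) (b * f) ⟨
    (a * c - b * d) + (a * e - b * f) ∎

  im-distribˡ : ∀ a b c d e f →
    a * (d + f) + b * (c + e) ≈ (a * d + b * c) + (a * f + b * e)
  im-distribˡ a b c d e f =
    trans (+-cong (distribˡ a d f) (distribˡ b c e)) (interchange (a * d) (a * f) (b * c) (b * e))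

  re-identityˡ : ∀ a b → 1# * a - 0# * b ≈ a
  re-identityˡ a b = begin
    1# * a - 0# * b  ≈⟨ +-cong (*-identityˡ a) (-‿cong (zeroˡ b)) ⟩
    a - 0#           ≈⟨ +-congˡ -0#≈0# ⟩
    a + 0#           ≈⟨ +-identityʳ a ⟩
    a                ∎

  im-identityˡ : ∀ a b → 1# * b + 0# * a ≈ b
  im-identityˡ a b = trans (+-cong (*-identityˡ b) (zeroˡ a)) (+-identityʳ b)

  re-conj-* : ∀ a b c d → a * c - b * d ≈ a * c - (- b) * (- d)
  re-conj-* a b c d = +-congˡ (-‿cong (begin
    b * d            ≈⟨ -‿involutive (b * d) ⟨
    - - (b * d)      ≈⟨ -‿cong (-‿distribʳ-* b d) ⟩
    - (b * (- d))    ≈⟨ -‿distribˡ-* b (- d) ⟩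
    (- b) * (- d)    ∎))

  im-conj-* : ∀ a b c d → - (a * d + b * c) ≈ a * (- d) + (- b) * c
  im-conj-* a b c d = trans (sym (⁻¹-∙-comm (a * d) (b * c)))
    (+-cong (-‿distribʳ-* a d) (-‿distribˡ-* b c))

  re-conj-square : ∀ a b → a * a - (- b) * b ≈ a * a + b * b
  re-conj-square a b = +-congˡ (begin
    - ((- b) * b)    ≈⟨ -‿cong (-‿distribˡ-* b b) ⟨
    - - (b * b)      ≈⟨ -‿involutive (b * b) ⟩
    b * b            ∎)

  im-conj-square : ∀ a b → a * b + (- b) * a ≈ 0#
  im-conj-square a b = begin
    a * b + (- b) * a    ≈⟨ +-congˡ (-‿distribˡ-* b a) ⟨
    a * b - b * a        ≈⟨ +-congˡ (-‿cong (*-comm b a)) ⟩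
    a * b - a * b        ≈⟨ -‿inverseʳ (a * b) ⟩
    0#                   ∎

-- Null sequences of rationals

-- By definition `x ≈ℝ y` says that the termwise difference is null, so the laws of real equality
-- become closure properties of null sequences.
IsNull : (ℕ → ℚ) → Set
IsNull x = ∀ ε → 0ℚ ℚ.< ε → ∃[ N ] (∀ n → N ℕ.≤ n → ∣ x n ∣ ℚ.< ε)

null-resp : ∀ {x y} → (∀ n → x n ≡ y n) → IsNull x → IsNull y
null-resp x≗y null-x ε 0<ε with null-x ε 0<ε
... | N , small = N , λ n N≤n → ≡.subst (λ q → ∣ q ∣ ℚ.< ε) (x≗y n) (small n N≤n)

null-0 : IsNull (λ _ → 0ℚ)
null-0 ε 0<ε = 0 , λ _ _ → 0<ε

null-+ : ∀ {x y} → IsNull x → IsNull y → IsNull (λ n → x n ℚ.+ y n)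
null-+ {x} {y} null-x null-y ε 0<ε
  with null-x (ε ℚ.* ½) (0<ε*½ 0<ε) | null-y (ε ℚ.* ½) (0<ε*½ 0<ε)
... | M , smallˣ | N , smallʸ = M ℕ.⊔ N , λ n ≤n → ∣p+q∣<ε (x n) (y n) ε
  (smallˣ n (ℕ.m⊔n≤o⇒m≤o M N ≤n)) (smallʸ n (ℕ.m⊔n≤o⇒n≤o M N ≤n))

null-dominated : ∀ {x y} → (∀ n → ∣ x n ∣ ℚ.≤ ∣ y n ∣) → IsNull y → IsNull x
null-dominated ∣x∣≤∣y∣ null-y ε 0<ε with null-y ε 0<ε
... | N , small = N , λ n N≤n → ℚ.≤-<-trans (∣x∣≤∣y∣ n) (small n N≤n)

null-neg : ∀ {x} → IsNull x → IsNull (λ n → ℚ.- x n)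
null-neg {x} = null-dominated (λ n → ℚ.≤-reflexive (ℚ.∣-p∣≡∣p∣ (x n)))

-- A Cauchy sequence is eventually bounded by some `B`, so it suffices that `y` is eventually below
-- `ε ÷ B`.
null-*ˡ : ∀ {x y} → IsCauchy x → IsNull y → IsNull (λ n → x n ℚ.* y n)
null-*ˡ {x} {y} cauchy-x null-y ε 0<ε with cauchy⇒bounded x cauchy-x
... | B , 0<B , M , bounded with null-y _ (0<ε÷B 0<B 0<ε)
... | N , small = M ℕ.⊔ N , λ n ≤n → ∣p*q∣<ε (x n) (y n) ε 0<B
  (bounded n (ℕ.m⊔n≤o⇒m≤o M N ≤n)) (small n (ℕ.m⊔n≤o⇒n≤o M N ≤n))

-- The hypothesis is used at `ε ℚ.* ε`: a term with `ε ≤ ∣ x n ∣` would have a square of at least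
-- that size.
null-square : ∀ {x} → IsNull (λ n → x n ℚ.* x n) → IsNull x
null-square {x} null-x² ε 0<ε with null-x² (ε ℚ.* ε) (0<p*q 0<ε 0<ε)
... | N , small = N , λ n N≤n → ℚ.≰⇒> λ ε≤∣x∣ → ℚ.<-irrefl ≡.refl (ℚ.<-≤-trans (small n N≤n) (begin
  ε ℚ.* ε              ≤⟨ ℚ.*-monoʳ-≤-nonNeg ε {{ℚ.nonNegative (ℚ.<⇒≤ 0<ε)}} ε≤∣x∣ ⟩
  ∣ x n ∣ ℚ.* ε        ≤⟨ ℚ.*-monoˡ-≤-nonNeg ∣ x n ∣ {{ℚ.∣-∣-nonNeg (x n)}} ε≤∣x∣ ⟩
  ∣ x n ∣ ℚ.* ∣ x n ∣  ≡⟨ ℚ.∣p*q∣≡∣p∣*∣q∣ (x n) (x n) ⟨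
  ∣ x n ℚ.* x n ∣      ∎))
  where open ℚ.≤-Reasoning

-- The commutative ring of real numbers

open DifferenceIdentities ℚ.+-*-commutativeRing
open RingProperties ℚ.+-*-ring using () renaming (⁻¹-anti-homo-// to -‿anti-homo--)

-- Transfers to the reals every ring law that already holds term by term in the rationals.
≈ℝ-pointwise : ∀ {x y} → (∀ n → seq x n ≡ seq y n) → x ≈ℝ y
≈ℝ-pointwise {x} {y} x≗y =
  null-resp (λ n → ≡.sym (≡.trans (≡.cong (ℚ._- seq y n) (x≗y n)) (ℚ.+-inverseʳ (seq y n)))) null-0

ℝ-isCommutativeRing : IsCommutativeRing _≈ℝ_ _+ℝ_ _*ℝ_ -ℝ_ (fromℚ 0ℚ) (fromℚ 1ℚ)
ℝ-isCommutativeRing = record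
  { isRing = record
    { +-isAbelianGroup = record
      { isGroup = record
        { isMonoid = record
          { isSemigroup = record
            { isMagma = record
              { isEquivalence = record
                { refl  = λ {x} → ≈ℝ-pointwise {x} {x} (λ _ → ≡.refl)
                ; sym   = λ {x} {y} x≈y →
                    null-resp (λ n → -‿anti-homo-- (seq x n) (seq y n)) (null-neg x≈y)
                ; trans = λ {x} {y} {z} x≈y y≈z →
                    null-resp (λ n → [a-b]+[b-c]≈a-c (seq x n) (seq y n) (seq z n)) (null-+ x≈y y≈z)
                }
              ; ∙-cong = λ {x} {x′} {y} {y′} x≈ y≈ → null-resp
                  (λ n → [a-c]+[b-d]≈[a+b]-[c+d] (seq x n) (seq y n) (seq x′ n) (seq y′ n))
                  (null-+ x≈ y≈)
              }
            ; assoc = λ x y z → ≈ℝ-pointwise {(x +ℝ y) +ℝ z} {x +ℝ (y +ℝ z)}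
                (λ n → ℚ.+-assoc (seq x n) (seq y n) (seq z n))
            }
          ; identity = (λ x → ≈ℝ-pointwise {fromℚ 0ℚ +ℝ x} {x} (λ n → ℚ.+-identityˡ (seq x n)))
                     , (λ x → ≈ℝ-pointwise {x +ℝ fromℚ 0ℚ} {x} (λ n → ℚ.+-identityʳ (seq x n)))
          }
        ; inverse = (λ x → ≈ℝ-pointwise { -ℝ x +ℝ x} {fromℚ 0ℚ} (λ n → ℚ.+-inverseˡ (seq x n)))
                  , (λ x → ≈ℝ-pointwise {x +ℝ -ℝ x} {fromℚ 0ℚ} (λ n → ℚ.+-inverseʳ (seq x n)))
        ; ⁻¹-cong = λ {x} {y} x≈y →
            null-resp (λ n → ≡.sym (-a--c≈-[a-c] (seq x n) (seq y n))) (null-neg x≈y)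
        }
      ; comm = λ x y → ≈ℝ-pointwise {x +ℝ y} {y +ℝ x} (λ n → ℚ.+-comm (seq x n) (seq y n))
      }
    -- The difference `x y - x′ y′` is split as `x (y - y′) + (x - x′) y′`, where each summand is a
    -- Cauchy sequence times a null sequence.
    ; *-cong = λ {x} {x′} {y} {y′} x≈ y≈ → null-resp
        (λ n → ≡.trans (≡.cong (seq x n ℚ.* (seq y n ℚ.- seq y′ n) ℚ.+_)
                                (ℚ.*-comm (seq y′ n) (seq x n ℚ.- seq x′ n)))
                       (a[b-d]+[a-c]d≈ab-cd (seq x n) (seq y n) (seq x′ n) (seq y′ n)))
        (null-+ (null-*ˡ {seq x} (isCauchy x) y≈) (null-*ˡ {seq y′} (isCauchy y′) x≈))
    ; *-assoc = λ x y z → ≈ℝ-pointwise {(x *ℝ y) *ℝ z} {x *ℝ (y *ℝ z)}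
        (λ n → ℚ.*-assoc (seq x n) (seq y n) (seq z n))
    ; *-identity = (λ x → ≈ℝ-pointwise {fromℚ 1ℚ *ℝ x} {x} (λ n → ℚ.*-identityˡ (seq x n)))
                 , (λ x → ≈ℝ-pointwise {x *ℝ fromℚ 1ℚ} {x} (λ n → ℚ.*-identityʳ (seq x n)))
    ; distrib = (λ x y z → ≈ℝ-pointwise {x *ℝ (y +ℝ z)} {x *ℝ y +ℝ x *ℝ z}
                  (λ n → ℚ.*-distribˡ-+ (seq x n) (seq y n) (seq z n)))
              , (λ x y z → ≈ℝ-pointwise {(y +ℝ z) *ℝ x} {y *ℝ x +ℝ z *ℝ x}
                  (λ n → ℚ.*-distribʳ-+ (seq x n) (seq y n) (seq z n)))
    }
  ; *-comm = λ x y → ≈ℝ-pointwise {x *ℝ y} {y *ℝ x} (λ n → ℚ.*-comm (seq x n) (seq y n))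
  }

ℝ-commutativeRing : CommutativeRing 0ℓ 0ℓ
ℝ-commutativeRing = record { isCommutativeRing = ℝ-isCommutativeRing }

-- The commutative ring of complex numbers

module ℝ-Ring = CommutativeRing ℝ-commutativeRing
open ComplexIdentities ℝ-commutativeRing

≈ℂ-isEquivalence : IsEquivalence _≈ℂ_
≈ℂ-isEquivalence = record
  { refl  = λ {z} → ℝ-Ring.refl {re z} , ℝ-Ring.refl {im z}
  ; sym   = λ {z} {w} (r , i) → ℝ-Ring.sym {re z} {re w} r , ℝ-Ring.sym {im z} {im w} i
  ; trans = λ {z} {w} {v} (r , i) (r′ , i′) →
      ℝ-Ring.trans {re z} {re w} {re v} r r′ , ℝ-Ring.trans {im z} {im w} {im v} i i′
  }

ℂ-setoid : Setoid 0ℓ 0ℓ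
ℂ-setoid = record { isEquivalence = ≈ℂ-isEquivalence }

open Consequences ℂ-setoid using (comm∧idˡ⇒id; comm∧distrˡ⇒distr)

+ℂ-cong : Congruent₂ _≈ℂ_ _+ℂ_
+ℂ-cong {z} {z′} {w} {w′} (r , i) (r′ , i′) =
  ℝ-Ring.+-cong {re z} {re z′} {re w} {re w′} r r′ , ℝ-Ring.+-cong {im z} {im z′} {im w} {im w′} i i′

*ℂ-cong : Congruent₂ _≈ℂ_ _*ℂ_
*ℂ-cong {z} {z′} {w} {w′} (r , i) (r′ , i′) =
    ℝ-Ring.+-cong {re z *ℝ re w} {re z′ *ℝ re w′} { -ℝ (im z *ℝ im w)} { -ℝ (im z′ *ℝ im w′)}
      (ℝ-Ring.*-cong {re z} {re z′} {re w} {re w′} r r′)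
      (ℝ-Ring.-‿cong {im z *ℝ im w} {im z′ *ℝ im w′} (ℝ-Ring.*-cong {im z} {im z′} {im w} {im w′} i i′))
  , ℝ-Ring.+-cong {re z *ℝ im w} {re z′ *ℝ im w′} {im z *ℝ re w} {im z′ *ℝ re w′}
      (ℝ-Ring.*-cong {re z} {re z′} {im w} {im w′} r i′)
      (ℝ-Ring.*-cong {im z} {im z′} {re w} {re w′} i r′)

+ℂ-comm : Commutative _≈ℂ_ _+ℂ_
+ℂ-comm z w = ℝ-Ring.+-comm (re z) (re w) , ℝ-Ring.+-comm (im z) (im w)

*ℂ-comm : Commutative _≈ℂ_ _*ℂ_
*ℂ-comm (a +i b) (c +i d) = re-comm a b c d , im-comm a b c d

ℂ-isCommutativeRing : IsCommutativeRing _≈ℂ_ _+ℂ_ _*ℂ_ -ℂ_ 0ℂ 1ℂ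
ℂ-isCommutativeRing = record
  { isRing = record
    { +-isAbelianGroup = record
      { isGroup = record
        { isMonoid = record
          { isSemigroup = record
            { isMagma = record
              { isEquivalence = ≈ℂ-isEquivalence
              ; ∙-cong        = λ {z} {z′} {w} {w′} → +ℂ-cong {z} {z′} {w} {w′}
              }
            ; assoc = λ z w v →
                ℝ-Ring.+-assoc (re z) (re w) (re v) , ℝ-Ring.+-assoc (im z) (im w) (im v)
            }
          ; identity = (λ z → ℝ-Ring.+-identityˡ (re z) , ℝ-Ring.+-identityˡ (im z))
                     , (λ z → ℝ-Ring.+-identityʳ (re z) , ℝ-Ring.+-identityʳ (im z))
          }
        ; inverse = (λ z → ℝ-Ring.-‿inverseˡ (re z) , ℝ-Ring.-‿inverseˡ (im z))
                  , (λ z → ℝ-Ring.-‿inverseʳ (re z) , ℝ-Ring.-‿inverseʳ (im z))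
        ; ⁻¹-cong = λ {z} {w} (r , i) →
            ℝ-Ring.-‿cong {re z} {re w} r , ℝ-Ring.-‿cong {im z} {im w} i
        }
      ; comm = +ℂ-comm
      }
    ; *-cong = λ {z} {z′} {w} {w′} → *ℂ-cong {z} {z′} {w} {w′}
    ; *-assoc = λ (a +i b) (c +i d) (e +i f) → re-assoc a b c d e f , im-assoc a b c d e f
    ; *-identity = comm∧idˡ⇒id {_*ℂ_} *ℂ-comm {1ℂ} (λ (a +i b) → re-identityˡ a b , im-identityˡ a b)
    ; distrib = comm∧distrˡ⇒distr {_*ℂ_} {_+ℂ_} (λ {z} {z′} {w} {w′} → +ℂ-cong {z} {z′} {w} {w′}) *ℂ-comm
        (λ (a +i b) (c +i d) (e +i f) → re-distribˡ a b c d e f , im-distribˡ a b c d e f)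
    }
  ; *-comm = *ℂ-comm
  }

ℂ-commutativeRing : CommutativeRing 0ℓ 0ℓ
ℂ-commutativeRing = record { isCommutativeRing = ℂ-isCommutativeRing }

-- Positive definiteness of complex conjugation

-- Asking only that some representative be termwise nonnegative avoids all
-- ε-arguments in the closure properties.
NonNegℝ : ℝ → Set
NonNegℝ x = ∃[ y ] x ≈ℝ y × (∀ n → 0ℚ ℚ.≤ seq y n)

nonNegℝ-resp : ∀ {x y} → y ≈ℝ x → NonNegℝ x → NonNegℝ y
nonNegℝ-resp {x} {y} y≈x (x′ , x≈x′ , x′≥0) = x′ , ℝ-Ring.trans {y} {x} {x′} y≈x x≈x′ , x′≥0

nonNegℝ-+ : ∀ {x y} → NonNegℝ x → NonNegℝ y → NonNegℝ (x +ℝ y)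
nonNegℝ-+ {x} {y} (x′ , x≈x′ , x′≥0) (y′ , y≈y′ , y′≥0) =
  x′ +ℝ y′ , ℝ-Ring.+-cong {x} {x′} {y} {y′} x≈x′ y≈y′ , λ n → ℚ.+-mono-≤ (x′≥0 n) (y′≥0 n)

-- For termwise nonnegative representatives each term of `x′` is at most the corresponding term of
-- `x′ +ℝ y′`, which is null.
nonNegℝ-+-zeroˡ : ∀ {x y} → NonNegℝ x → NonNegℝ y → x +ℝ y ≈ℝ fromℚ 0ℚ → x ≈ℝ fromℚ 0ℚ
nonNegℝ-+-zeroˡ {x} {y} (x′ , x≈x′ , x′≥0) (y′ , y≈y′ , y′≥0) x+y≈0 =
  ℝ-Ring.trans {x} {x′} {fromℚ 0ℚ} x≈x′ (null-dominated dominated x′+y′≈0)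
  where
  x′+y′≈0 : x′ +ℝ y′ ≈ℝ fromℚ 0ℚ
  x′+y′≈0 = ℝ-Ring.trans {x′ +ℝ y′} {x +ℝ y} {fromℚ 0ℚ}
    (ℝ-Ring.sym {x +ℝ y} {x′ +ℝ y′} (ℝ-Ring.+-cong {x} {x′} {y} {y′} x≈x′ y≈y′)) x+y≈0

  open ℚ.≤-Reasoning
  dominated : ∀ n → ∣ seq x′ n ℚ.- 0ℚ ∣ ℚ.≤ ∣ seq x′ n ℚ.+ seq y′ n ℚ.- 0ℚ ∣
  dominated n = begin
    ∣ seq x′ n ℚ.- 0ℚ ∣               ≡⟨ ≡.cong ∣_∣ (ℚ.+-identityʳ (seq x′ n)) ⟩
    ∣ seq x′ n ∣                      ≡⟨ ℚ.0≤p⇒∣p∣≡p (x′≥0 n) ⟩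
    seq x′ n                          ≡⟨ ℚ.+-identityʳ (seq x′ n) ⟨
    seq x′ n ℚ.+ 0ℚ                   ≤⟨ ℚ.+-monoʳ-≤ (seq x′ n) (y′≥0 n) ⟩
    seq x′ n ℚ.+ seq y′ n             ≡⟨ ℚ.0≤p⇒∣p∣≡p (ℚ.+-mono-≤ (x′≥0 n) (y′≥0 n)) ⟨
    ∣ seq x′ n ℚ.+ seq y′ n ∣         ≡⟨ ≡.cong ∣_∣ (ℚ.+-identityʳ (seq x′ n ℚ.+ seq y′ n)) ⟨
    ∣ seq x′ n ℚ.+ seq y′ n ℚ.- 0ℚ ∣  ∎

0≤p*p : ∀ p → 0ℚ ℚ.≤ p ℚ.* p
0≤p*p p = ≡.subst (ℚ._≤ p ℚ.* p) (ℚ.*-zeroʳ p)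
  ([ (λ 0≤p → ℚ.*-monoˡ-≤-nonNeg p {{ℚ.nonNegative 0≤p}} 0≤p)
   , (λ p≤0 → ℚ.*-monoˡ-≤-nonPos p {{ℚ.nonPositive p≤0}} p≤0)
   ]′ (ℚ.≤-total 0ℚ p))

nonNegℝ-square : ∀ x → NonNegℝ (x *ℝ x)
nonNegℝ-square x = x *ℝ x , ℝ-Ring.refl {x *ℝ x} , λ n → 0≤p*p (seq x n)

square-definite : ∀ x → x *ℝ x ≈ℝ fromℚ 0ℚ → x ≈ℝ fromℚ 0ℚ
square-definite x x²≈0 =
  null-resp (λ n → ≡.sym (ℚ.+-identityʳ (seq x n)))
    (null-square (null-resp (λ n → ℚ.+-identityʳ (seq x n ℚ.* seq x n)) x²≈0))

conj-* : ∀ z w → conj (z *ℂ w) ≈ℂ conj z *ℂ conj w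
conj-* (a +i b) (c +i d) = re-conj-* a b c d , im-conj-* a b c d

-- Fixing the imaginary part at zero lets `nonNeg-+-zeroˡ` conclude that a summand vanishes in both
-- components.
NonNegℂ : ℂ → Set
NonNegℂ z = NonNegℝ (re z) × im z ≈ℝ fromℚ 0ℚ

conj-square-re : ∀ z → re (conj z *ℂ z) ≈ℝ re z *ℝ re z +ℝ im z *ℝ im z
conj-square-re (a +i b) = re-conj-square a b

-- The real part of `conj z *ℂ z` is the sum of the squares of the two components, and each square
-- is nonnegative.
conj-square-definite : ∀ z → conj z *ℂ z ≈ℂ 0ℂ → z ≈ℂ 0ℂ
conj-square-definite z@(a +i b) (r , _) =
    square-definite a (nonNegℝ-+-zeroˡ {a²} {b²} (nonNegℝ-square a) (nonNegℝ-square b) a²+b²≈0)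
  , square-definite b (nonNegℝ-+-zeroˡ {b²} {a²} (nonNegℝ-square b) (nonNegℝ-square a)
      (ℝ-Ring.trans {b² +ℝ a²} {a² +ℝ b²} {fromℚ 0ℚ} (ℝ-Ring.+-comm b² a²) a²+b²≈0))
  where
  a² = a *ℝ a
  b² = b *ℝ b
  a²+b²≈0 : a² +ℝ b² ≈ℝ fromℚ 0ℚ
  a²+b²≈0 = ℝ-Ring.trans {a² +ℝ b²} {re (conj z *ℂ z)} {fromℚ 0ℚ}
    (ℝ-Ring.sym {re (conj z *ℂ z)} {a² +ℝ b²} (conj-square-re z)) r

conj-positive : PositiveConjugation ℂ-commutativeRing 0ℓ
conj-positive = record
  { _⋆             = conj
  ; ⋆-cong         = λ {z} {w} (r , i) → r , ℝ-Ring.-‿cong {im z} {im w} i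
  ; ⋆-+            = λ z w → ℝ-Ring.refl {re z +ℝ re w}
      , ≈ℝ-pointwise {im (conj (z +ℂ w))} {im (conj z +ℂ conj w)}
          (λ n → ℚ.neg-distrib-+ (seq (im z) n) (seq (im w) n))
  ; ⋆-*            = conj-*
  ; ⋆-0            = ℝ-Ring.refl {fromℚ 0ℚ} , ≈ℝ-pointwise { -ℝ fromℚ 0ℚ} {fromℚ 0ℚ} (λ _ → ≡.refl)
  ; NonNeg         = NonNegℂ
  ; nonNeg-0       = (fromℚ 0ℚ , ℝ-Ring.refl {fromℚ 0ℚ} , λ _ → ℚ.≤-refl) , ℝ-Ring.refl {fromℚ 0ℚ}
  ; nonNeg-+       = λ {z} {w} (z≥0 , i) (w≥0 , j) →
      nonNegℝ-+ {re z} {re w} z≥0 w≥0 , im-+-zero z w i j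
  ; nonNeg-+-zeroˡ = λ {z} {w} (z≥0 , i) (w≥0 , _) (r , _) →
      nonNegℝ-+-zeroˡ {re z} {re w} z≥0 w≥0 r , i
  ; nonNeg-⋆*      = λ z →
      nonNegℝ-resp {re z *ℝ re z +ℝ im z *ℝ im z} {re (conj z *ℂ z)} (conj-square-re z)
        (nonNegℝ-+ {re z *ℝ re z} {im z *ℝ im z} (nonNegℝ-square (re z)) (nonNegℝ-square (im z)))
      , im-conj-square (re z) (im z)
  ; ⋆*-definite    = conj-square-definite
  }
  where
  im-+-zero : ∀ z w → im z ≈ℝ fromℚ 0ℚ → im w ≈ℝ fromℚ 0ℚ → im (z +ℂ w) ≈ℝ fromℚ 0ℚ
  im-+-zero z w i j = ℝ-Ring.trans {im z +ℝ im w} {fromℚ 0ℚ +ℝ fromℚ 0ℚ} {fromℚ 0ℚ}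
    (ℝ-Ring.+-cong {im z} {fromℚ 0ℚ} {im w} {fromℚ 0ℚ} i j) (ℝ-Ring.+-identityˡ (fromℚ 0ℚ))

-- Measurements and quantum homomorphisms

open MatrixAlgebra ℂ-commutativeRing conj-positive
module ℂ-Ring = CommutativeRing ℂ-commutativeRing

-- The abstract matrix operations at the complex numbers unfold to the concrete ones, and `K N`
-- enumerates its vertices by the identity, so the fields carry over unchanged.
measurement⇒pvm : ∀ {N d} (𝐄 : Measurement (K N) d) → IsPVM (E 𝐄)
measurement⇒pvm 𝐄 = record
  { isProjector = λ k → record
    { selfAdjoint = IsOrthogonalProjector.selfAdjoint (Measurement.isProjector 𝐄 k)
    ; idempotent  = IsOrthogonalProjector.idempotent (Measurement.isProjector 𝐄 k)
    }
  ; complete = Measurement.complete 𝐄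
  }

pvm⇒measurement : ∀ {N d} {P : Fin N → Matrix d} → IsPVM P → Measurement (K N) d
pvm⇒measurement {P = P} isPVM = record
  { E           = P
  ; isProjector = λ k → record { selfAdjoint = selfAdjoint k ; idempotent = idempotent k }
  ; complete    = complete
  }
  where open IsPVM isPVM

pad : ∀ {n d} → Measurement (K n) d → Measurement (K (ℕ.suc n)) d
pad {n} {d} 𝐄 = record
  { E           = padded
  ; isProjector = isProjector
  -- The zero projector sits at index `zero`, so it contributes a leading `0ℂ` to the old sum.
  ; complete    = λ x y → ℂ-Ring.trans {0ℂ +ℂ ΣE x y} {ΣE x y} {1ᴹ x y}
      (ℂ-Ring.+-identityˡ (ΣE x y)) (Measurement.complete 𝐄 x y)
  }
  where
  ΣE : Matrix d
  ΣE = sumᴹ (E 𝐄)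
  padded : Fin (ℕ.suc n) → Matrix d
  padded zero    = 0ᴹ
  padded (suc k) = E 𝐄 k
  isProjector : ∀ k → IsOrthogonalProjector (padded k)
  isProjector zero    = record
    { selfAdjoint = λ _ _ → PositiveConjugation.⋆-0 conj-positive
    ; idempotent  = ·-zeroˡ {A = 0ᴹ} 0ᴹ (λ _ _ → ℂ-Ring.refl {0ℂ})
    }
  isProjector (suc k) = Measurement.isProjector 𝐄 k

-- In M (K n) d only the products of equally indexed projectors are constrained.
Disjoint : ∀ {n d} → Measurement (K n) d → Measurement (K n) d → Set
Disjoint 𝐄 𝐄′ = ∀ k → E 𝐄 k *ᴹ E 𝐄′ k ≈ᴹ 0ᴹ

adjacent⇒disjoint : ∀ {n d} {𝐄 𝐄′ : Measurement (K n) d} →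
                    Graph._∼_ (M (K n) d) 𝐄 𝐄′ → Disjoint 𝐄 𝐄′
adjacent⇒disjoint 𝐄∼𝐄′ k = 𝐄∼𝐄′ k k (λ k≢k → k≢k ≡.refl)

disjoint⇒adjacent : ∀ {n d} {𝐄 𝐄′ : Measurement (K n) d} →
                    Disjoint 𝐄 𝐄′ → Graph._∼_ (M (K n) d) 𝐄 𝐄′
-- Adjacency in `K n` is inequality, so non-adjacency is a doubly negated equality, which
-- decidability on `Fin n` makes an equality.
disjoint⇒adjacent disjoint k l k≁l with decidable-stable (k Fin.≟ l) k≁l
... | ≡.refl = disjoint k

pad-disjoint : ∀ {n d} {𝐄 𝐄′ : Measurement (K n) d} → Disjoint 𝐄 𝐄′ → Disjoint (pad 𝐄) (pad 𝐄′)
pad-disjoint disjoint zero    = ·-zeroˡ {A = 0ᴹ} 0ᴹ (λ _ _ → ℂ-Ring.refl {0ℂ})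
pad-disjoint disjoint (suc k) = disjoint k

-- Operations on quantum homomorphisms

quantumHom-pad : ∀ {G n} → QuantumHom G (K n) → QuantumHom G (K (ℕ.suc n))
quantumHom-pad (d , 1≤d , f) = d , 1≤d , record
  { map   = λ u → pad (map u)
  ; isHom = record { cong = λ u∼v →
      disjoint⇒adjacent {𝐄 = pad (map _)} {pad (map _)}
       (pad-disjoint {𝐄 = map _} {map _} (adjacent⇒disjoint {𝐄 = map _} {map _} (isHom.cong u∼v))) }
  }
  where
  open Hom f
  module isHom = IsRelHomomorphism isHom

quantumHom-mono : ∀ {G m n} → m ≤′ n → QuantumHom G (K m) → QuantumHom G (K n)
quantumHom-mono     ≤′-refl       f = f
quantumHom-mono {G} (≤′-step m≤n) f = quantumHom-pad {G} (quantumHom-mono {G} m≤n f)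

quantumHom-∘ : ∀ {G G′ X} → Hom (graph G) (graph G′) → QuantumHom G′ X → QuantumHom G X
quantumHom-∘ f (d , 1≤d , g) = d , 1≤d , record
  { map   = λ u → Hom.map g (Hom.map f u)
  ; isHom = record { cong = λ u∼v →
      IsRelHomomorphism.cong (Hom.isHom g) (IsRelHomomorphism.cong (Hom.isHom f) u∼v) }
  }

-- The copy of `G` lies over a chosen vertex of `H`; if `H` had no vertices, the product would be
-- empty and could not receive a nonempty `G`.
□-fibreˡ : ∀ G H → Vertex H → Hom (graph G) (graph (G □ H))
□-fibreˡ G H v = record
  { map = λ u → u , v ; isHom = record { cong = λ u∼u′ → inj₁ (u∼u′ , ≡.refl) } }

□-fibreʳ : ∀ G H → Vertex G → Hom (graph H) (graph (G □ H))
□-fibreʳ G H u = record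
  { map = λ v → u , v ; isHom = record { cong = λ v∼v′ → inj₂ (≡.refl , v∼v′) } }

-- An edge of the product moves one coordinate only, so the measurement of the other coordinate is
-- the same at both ends, as the disjointness lemmas for `_⊛_` require.
quantumHom-□ : ∀ {G H N} → QuantumHom G (K N) → QuantumHom H (K N) → QuantumHom (G □ H) (K N)
quantumHom-□ {G} {H} {N} (d , 1≤d , f) (e , 1≤e , g) = d ℕ.* e , ℕ.*-mono-≤ 1≤d 1≤e , record
  { map   = product
  ; isHom = record { cong = λ {x} {y} → product-cong {x} {y} }
  }
  where
  open FiniteGraph (G □ H) using () renaming (_∼_ to _∼□_)
  module f = Hom f
  module g = Hom g
  product : Vertex (G □ H) → Measurement (K N) (d ℕ.* e)
  product (u , v) = pvm⇒measurement (⊛-isPVM (measurement⇒pvm (f.map u)) (measurement⇒pvm (g.map v)))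
  product-cong : ∀ {x y} → x ∼□ y → Graph._∼_ (M (K N) (d ℕ.* e)) (product x) (product y)
  product-cong {u , v} {u′ , .v} (inj₁ (u∼u′ , ≡.refl)) =
    disjoint⇒adjacent {𝐄 = product (u , v)} {product (u′ , v)}
      (⊛-disjointˡ {P = E (f.map u)} {E (f.map u′)} (measurement⇒pvm (g.map v))
        (adjacent⇒disjoint {𝐄 = f.map u} {f.map u′} (IsRelHomomorphism.cong f.isHom u∼u′)))
  product-cong {u , v} {.u , v′} (inj₂ (≡.refl , v∼v′)) =
    disjoint⇒adjacent {𝐄 = product (u , v)} {product (u , v′)}
      (⊛-disjointʳ {Q = E (g.map v)} {E (g.map v′)} (measurement⇒pvm (f.map u))
        (adjacent⇒disjoint {𝐄 = g.map v} {g.map v′} (IsRelHomomorphism.cong g.isHom v∼v′)))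

theorem7p2 : (G H : FiniteGraph) → Vertex G → Vertex H →
    (m n : ℕ) → χq G ≐ m → χq H ≐ n → χq (G □ H) ≐ (m ⊔ n)
theorem7p2 G H u v m n (f , m-least) (g , n-least) =
    quantumHom-□ {G} {H} (quantumHom-mono {G} (ℕ.≤⇒≤′ (ℕ.m≤m⊔n m n)) f)
                 (quantumHom-mono {H} (ℕ.≤⇒≤′ (ℕ.m≤n⊔m m n)) g)
  -- Restricting `h` to the fibre over `v` and to the fibre over `u` shows that `k` bounds both `m`
  -- and `n`.
  , λ k h → ℕ.⊔-lub
      (m-least k (quantumHom-∘ {G} {G □ H} {K k} (□-fibreˡ G H v) h))
      (n-least k (quantumHom-∘ {H} {G □ H} {K k} (□-fibreʳ G H u) h))
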